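{- Assume that condition $\mathrm{(H1)}(r)$ below holds for every $r\ge0$. Then for every $r\ge0$ the word $P_r$ is anti-palindromic, i.e. $P_r[k]+P_r[2a_r-1-k]=1$ for all $0\le k\le 2a_r-1$.
   Context: Let $\widetilde Q(1)=\widetilde Q(2)=1$ and $\widetilde Q(n)=\widetilde Q(n-\widetilde Q(n-1))+\widetilde Q(n-\widetilde Q(n-2))+(-1)^n$ for $n\ge3$ (this is well defined, and all values are odd). Put $A(m):=(\widetilde Q(2m-1)+1)/2$, $B(m):=(\widetilde Q(2m)+1)/2$, $\delta(m):=B(m)-A(m)$, $\Delta A(m):=A(m+1)-A(m)$, $\Delta B(m):=B(m+1)-B(m)$. For $r\ge0$ let $a_r:=(2\cdot4^{r+1}+1)/3$ (so $a_0=3$, $a_{r+1}=4a_r-1$), $u_r:=2a_r-r-2$, $v_r:=4a_r-r-2$. The step word is $P_r:=(\Delta A(m))_{m=u_r}^{v_r-1}$, indexed from $0$, of length $2a_r$. Condition $\mathrm{(H1)}(r)$ means: $A(u_r)=B(u_r)=a_r$; $A(v_r)=B(v_r)=2a_r$; $B(u_r+1)=a_r+1$, $A(v_r-1)=2a_r-1$, $B(v_r-1)=2a_r$, $A(u_{r+1}-1)=a_{r+1}$, $B(u_{r+1}-1)=a_{r+1}-1$; and $\delta(m)\ge0$ for $u_r\le m\le v_r$, with $\delta(m)\ge1$ for $u_r<m<v_r$. -}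

module Defs where

open import Data.Nat using (ℕ; zero; suc; _+_; _*_; _∸_; _^_; _≤_; _<_; _≡ᵇ_)
open import Data.Nat.DivMod using (_/_)
open import Data.Bool using (if_then_else_)
open import Data.Integer using (ℤ; +_) renaming (_-_ to _-ℤ_)
open import Data.Product using (_×_)
open import Relation.Binary.PropositionalEquality using (_≡_)

isEven : ℕ → Data.Bool.Bool
isEven zero = Data.Bool.true
isEven (suc n) = Data.Bool.not (isEven n)

-- one recursion step of Q̃ at index n, given the values f k for k < n.
-- Q̃(1)=Q̃(2)=1; for n ≥ 3: Q̃(n-Q̃(n-1)) + Q̃(n-Q̃(n-2)) + (-1)^n.
-- (index 0 is a dummy; the recursion is well defined, so it is never used,
--  and the sum is ≥ 2 so the truncated ∸ 1 is exact.)
step : (ℕ → ℕ) → ℕ → ℕ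
step f zero = 1
step f (suc zero) = 1
step f (suc (suc zero)) = 1
step f n@(suc (suc (suc _))) =
  let s = f (n ∸ f (n ∸ 1)) + f (n ∸ f (n ∸ 2)) in
  if isEven n then s + 1 else s ∸ 1

-- tab n k = Q̃(k) for k ≤ n
tab : ℕ → ℕ → ℕ
tab zero k = step (λ _ → 1) zero
tab (suc n) k = if k ≡ᵇ suc n then step (tab n) (suc n) else tab n k

Qt : ℕ → ℕ
Qt n = tab n n

A : ℕ → ℕ
A m = (Qt (2 * m ∸ 1) + 1) / 2

B : ℕ → ℕ
B m = (Qt (2 * m) + 1) / 2

δ : ℕ → ℤ
δ m = + B m -ℤ + A m

ΔA : ℕ → ℤ
ΔA m = + A (suc m) -ℤ + A m

a : ℕ → ℕ
a r = (2 * 4 ^ (r + 1) + 1) / 3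

u : ℕ → ℕ
u r = 2 * a r ∸ r ∸ 2

v : ℕ → ℕ
v r = 4 * a r ∸ r ∸ 2

-- the step word P_r, indexed from 0 (meaningful for k < 2 a_r)
P : ℕ → ℕ → ℤ
P r k = ΔA (u r + k)

record H1 (r : ℕ) : Set where
  field
    Au   : A (u r) ≡ a r
    Bu   : B (u r) ≡ a r
    Av   : A (v r) ≡ 2 * a r
    Bv   : B (v r) ≡ 2 * a r
    Bu+1 : B (u r + 1) ≡ a r + 1
    Av-1 : A (v r ∸ 1) ≡ 2 * a r ∸ 1
    Bv-1 : B (v r ∸ 1) ≡ 2 * a r
    Au'  : A (u (suc r) ∸ 1) ≡ a (suc r)
    Bu'  : B (u (suc r) ∸ 1) ≡ a (suc r) ∸ 1
    δ≥0  : ∀ m → u r ≤ m → m ≤ v r → A m ≤ B m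
    δ≥1  : ∀ m → u r < m → m < v r → A m < B m

{-# OPTIONS --safe #-}
module Submission where

-- On [u_r , v_r] the pair (B , A), and on [v_r , u_{r+1}] the pair (A(m+1) , B(m)),
-- traces a lattice path from (0 , 0) to (L , L), up to translation.  Each path is
-- driven by a word φ: after a step that brings a coordinate to the value z, the next
-- step goes north iff φ z.  The word driving a path is, up to a shift, the step word of
-- the path before it.  In such a path the step after a coordinate arrives at z has the
-- same direction as the step before that coordinate leaves z, so the rule is invariant
-- under time reversal.  Hence, if φ is antisymmetric under z ↦ L − z, the reflection
-- (x , y) ↦ (L − y , L − x) maps the path to its own reversal: its step word is
-- antisymmetric too, and the property propagates from block to block.

open import Defs
open import Algebra.Properties.CommutativeSemigroup using (x∙yz≈y∙xz)
open import Data.Bool using (Bool; true; false; not; if_then_else_)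
open import Data.Bool.Properties using (not-involutive)
open import Data.Integer using (1ℤ; _⊖_) renaming (_+_ to _+ℤ_; _-_ to _-ℤ_; +_ to toℤ)
import Data.Integer.Properties as ℤ
open import Data.Nat using (ℕ; zero; suc; _+_; _*_; _∸_; _^_; _≤_; _<_; z≤n; s≤s; _≡ᵇ_)
open import Data.Nat.DivMod using (_/_; m*n/n≡m)
open import Data.Nat.Induction using (<-rec)
open import Data.Nat.Properties
open import Data.Nat.Tactic.RingSolver using (solve-∀)
open import Data.Product using (_×_; _,_; proj₁; proj₂; ∃)
open import Data.Sum using (_⊎_; inj₁; inj₂)
open import Function using (_∘_)
open import Relation.Binary.PropositionalEquality
open import Relation.Nullary using (yes; no)

-- Words and the lattice paths they drive.

bit : Bool → ℕ
bit false = 0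
bit true  = 1

false⊎true : ∀ b → b ≡ false ⊎ b ≡ true
false⊎true false = inj₁ refl
false⊎true true  = inj₂ refl

count : (ℕ → Bool) → ℕ → ℕ
count f zero    = 0
count f (suc n) = bit (f n) + count f n

Antisymmetric : (ℕ → Bool) → ℕ → Set
Antisymmetric φ L = ∀ i j → i + j ≡ L → φ i ≡ not (φ j)

module Path (φ : ℕ → Bool) where

  -- `dir n` is the step from point `n` to point `suc n`, with `true` for north. The first step has
  -- no coordinate just reached to consult and is fixed as east; the condition `φ 0 ≡ false` imposed
  -- below agrees with this choice.
  dir   : ℕ → Bool
  east  : ℕ → ℕ
  north : ℕ → ℕ

  dir zero    = false
  dir (suc n) = φ (if dir n then north (suc n) else east (suc n))

  east zero    = 0
  east (suc n) = bit (not (dir n)) + east n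

  north zero    = 0
  north (suc n) = bit (dir n) + north n

  east+north : ∀ n → east n + north n ≡ n
  east+north zero = refl
  east+north (suc n) with dir n
  ... | false = cong suc (east+north n)
  ... | true  = trans (+-suc (east n) (north n)) (cong suc (east+north n))

  east-suc : ∀ n → ∃ λ x → east (suc n) ≡ suc x
  east-suc zero = 0 , refl
  east-suc (suc n) with dir (suc n)
  ... | false = east (suc n) , refl
  ... | true  = east-suc n

  east≡count : ∀ n → east n ≡ count (not ∘ dir) n
  east≡count zero    = refl
  east≡count (suc n) = cong (bit (not (dir n)) +_) (east≡count n)

  north≡count : ∀ n → north n ≡ count dir n
  north≡count zero    = refl
  north≡count (suc n) = cong (bit (dir n) +_) (north≡count n)

  east-mono : ∀ m d → east m ≤ east (m + d)
  east-mono m zero    = ≤-reflexive (cong east (sym (+-identityʳ m)))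
  east-mono m (suc d) rewrite +-suc m d = ≤-trans (east-mono m d) (m≤n+m _ (bit (not (dir (m + d)))))

  north-mono : ∀ m d → north m ≤ north (m + d)
  north-mono m zero    = ≤-reflexive (cong north (sym (+-identityʳ m)))
  north-mono m (suc d) rewrite +-suc m d = ≤-trans (north-mono m d) (m≤n+m _ (bit (dir (m + d))))

  dir-after-east : ∀ n → dir n ≡ false → dir (suc n) ≡ φ (east (suc n))
  dir-after-east n p = cong (λ b → φ (if b then north (suc n) else east (suc n))) p

  dir-after-north : ∀ n → dir n ≡ true → dir (suc n) ≡ φ (north (suc n))
  dir-after-north n p = cong (λ b → φ (if b then north (suc n) else east (suc n))) p

  east-on-east : ∀ n → dir n ≡ false → east (suc n) ≡ suc (east n)
  east-on-east n p = cong (λ b → bit (not b) + east n) p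

  east-on-north : ∀ n → dir n ≡ true → east (suc n) ≡ east n
  east-on-north n p = cong (λ b → bit (not b) + east n) p

  north-on-east : ∀ n → dir n ≡ false → north (suc n) ≡ north n
  north-on-east n p = cong (λ b → bit b + north n) p

  north-on-north : ∀ n → dir n ≡ true → north (suc n) ≡ suc (north n)
  north-on-north n p = cong (λ b → bit b + north n) p

  -- Time reversal of the rule, and counting of steps.

  module _ (φ0 : φ 0 ≡ false) where

    -- The coordinate left alone by a step was last changed by a step whose
    -- successor went in the same direction as the present one.
    φ-north-on-east : ∀ n → dir n ≡ false → φ (north n) ≡ false
    φ-north-on-east zero    _ = φ0
    φ-north-on-east (suc n) q with false⊎true (dir n)
    ... | inj₁ p = trans (cong φ (north-on-east n p)) (φ-north-on-east n p)
    ... | inj₂ p = trans (sym (dir-after-north n p)) q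

    φ-east-on-north : ∀ n → dir n ≡ true → φ (east n) ≡ true
    φ-east-on-north (suc n) q with false⊎true (dir n)
    ... | inj₁ p = trans (sym (dir-after-east n p)) q
    ... | inj₂ p = trans (cong φ (east-on-north n p)) (φ-east-on-north n p)

    -- Time reversal of the defining rule: a step is governed by the
    -- coordinate that the next step changes.
    dir-before-east : ∀ n → dir (suc n) ≡ false → dir n ≡ φ (east (suc n))
    dir-before-east n q with false⊎true (dir n)
    ... | inj₁ p = trans p (trans (sym q) (dir-after-east n p))
    ... | inj₂ p = trans p (sym (trans (cong φ (east-on-north n p)) (φ-east-on-north n p)))

    dir-before-north : ∀ n → dir (suc n) ≡ true → dir n ≡ φ (north (suc n))
    dir-before-north n q with false⊎true (dir n)
    ... | inj₁ p = trans p (sym (trans (cong φ (north-on-east n p)) (φ-north-on-east n p)))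
    ... | inj₂ p = trans p (trans (sym q) (dir-after-north n p))

    -- Step 0 is east. Each later step up to step `n` is `φ` at the value just reached, and these
    -- values run once through 1 to `east n` and once through 1 to `north n`. The two letters at 0
    -- add nothing. The recursions for `A` and `B` produce this same sum of two counts.
    north-suc≡counts : ∀ n → north (suc n) ≡ count φ (suc (east n)) + count φ (suc (north n))
    north-suc≡counts zero rewrite φ0 = refl
    north-suc≡counts (suc n) with false⊎true (dir n)
    ... | inj₁ p = begin
      bit (dir (suc n)) + north (suc n)
        ≡⟨ cong₂ (λ b m → bit b + m) (dir-after-east n p) (north-suc≡counts n) ⟩
      bit (φ (east (suc n))) + (count φ (suc (east n)) + count φ (suc (north n)))
        ≡⟨ +-assoc (bit (φ (east (suc n)))) _ _ ⟨
      bit (φ (east (suc n))) + count φ (suc (east n)) + count φ (suc (north n))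
        ≡⟨ cong₂ (λ x y → bit (φ (east (suc n))) + count φ x + count φ (suc y))
             (east-on-east n p) (north-on-east n p) ⟨
      count φ (suc (east (suc n))) + count φ (suc (north (suc n))) ∎
      where open ≡-Reasoning
    ... | inj₂ p = begin
      bit (dir (suc n)) + north (suc n)
        ≡⟨ cong₂ (λ b m → bit b + m) (dir-after-north n p) (north-suc≡counts n) ⟩
      bit (φ (north (suc n))) + (count φ (suc (east n)) + count φ (suc (north n)))
        ≡⟨ x∙yz≈y∙xz +-commutativeSemigroup (bit (φ (north (suc n)))) (count φ (suc (east n))) (count φ (suc (north n))) ⟩
      count φ (suc (east n)) + (bit (φ (north (suc n))) + count φ (suc (north n)))
        ≡⟨ cong₂ (λ x y → count φ (suc x) + (bit (φ (north (suc n))) + count φ y))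
             (east-on-north n p) (north-on-north n p) ⟨
      count φ (suc (east (suc n))) + count φ (suc (north (suc n))) ∎
      where open ≡-Reasoning

    -- The complementary count, with `east (suc n)` in place of `suc (east n)` as first bound. The
    -- two differ only when step `n` is north, and then the extra letter `φ (east n)` is `true`. The
    -- recursions lead to this form because they compute the east coordinate from the already
    -- updated north one.
    east-suc≡counts : ∀ n → suc (east (suc n)) ≡
      count (not ∘ φ) (east (suc n)) + count (not ∘ φ) (suc (north n))
    east-suc≡counts zero rewrite φ0 = refl
    east-suc≡counts (suc n) = cases (false⊎true (dir n)) (false⊎true (dir (suc n)))
      where
      C = count (not ∘ φ)
      e = east (suc n)
      Goal : ℕ → ℕ → Set
      Goal x y = suc x ≡ C x + C (suc y)
      ih : Goal e (north n)
      ih = east-suc≡counts n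
      bit-φ : ∀ {i b} → φ i ≡ b → bit (not (φ i)) ≡ bit (not b)
      bit-φ = cong (bit ∘ not)
      cases : dir n ≡ false ⊎ dir n ≡ true → dir (suc n) ≡ false ⊎ dir (suc n) ≡ true →
        Goal (east (suc (suc n))) (north (suc n))
      cases (inj₁ p) (inj₁ q) =
        subst₂ Goal (sym (east-on-east (suc n) q)) (sym (north-on-east n p))
          (trans (cong suc ih) (cong (λ b → b + C e + C (suc (north n)))
            (sym (bit-φ (trans (sym (dir-after-east n p)) q)))))
      cases (inj₁ p) (inj₂ q) =
        subst₂ Goal (sym (east-on-north (suc n) q)) (sym (north-on-east n p)) ih
      -- The `east` value newly counted has letter `true` and adds nothing; the increment comes from
      -- the letter `false` at the new `north` value.
      cases (inj₂ p) (inj₁ q) =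
        subst₂ Goal (sym (east-on-east (suc n) q)) refl
          (trans (cong suc ih) (trans (sym (+-suc (C e) _))
            (cong₂ (λ b c → b + C e + c)
              (sym (bit-φ (trans (cong φ (east-on-north n p)) (φ-east-on-north n p))))
              (cong₂ _+_ (sym (bit-φ (trans (sym (dir-after-north n p)) q)))
                (cong C (sym (north-on-north n p)))))))
      cases (inj₂ p) (inj₂ q) =
        subst₂ Goal (sym (east-on-north (suc n) q)) refl
          (trans ih (cong (C e +_)
            (cong₂ _+_ (sym (bit-φ (trans (sym (dir-after-north n p)) q)))
              (cong C (sym (north-on-north n p))))))

    -- Reflection of a path driven by an antisymmetric word.

    module _ {L : ℕ} (anti : Antisymmetric φ L) where

      -- Point `m` is the mirror image of point `suc n`, so step `m` is compared with step `n` run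
      -- backwards. Reversal followed by reflection exchanges east and north, whence the `not`.
      Reflected : ℕ → ℕ → Set
      Reflected m n =
        dir m ≡ not (dir n) × east m + north (suc n) ≡ L × north m + east (suc n) ≡ L

      -- Induction outward from the middle of a path of `L + L` steps: `j = 0` concerns the two
      -- steps that meet at point `L`, and each further stage moves one step forward on one side and
      -- one step back on the other.
      reflected : ∀ j n → suc n + j ≡ L → Reflected (L + j) n
      reflected zero n e rewrite +-identityʳ n | +-identityʳ L with e
      ... | refl = mid , east+north (suc n) , trans (+-comm (north (suc n)) _) (east+north (suc n))
        where
        -- The middle point lies on the axis: its coordinates sum to `L`, so their letters are
        -- opposite. The letter at the coordinate just reached is the next step; the letter at the
        -- one left alone equals the previous step.
        mid : dir (suc n) ≡ not (dir n)
        mid with false⊎true (dir n)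
        ... | inj₁ p = begin
          dir (suc n)               ≡⟨ dir-after-east n p ⟩
          φ (east (suc n))          ≡⟨ anti _ _ (east+north (suc n)) ⟩
          not (φ (north (suc n)))   ≡⟨ cong (not ∘ φ) (north-on-east n p) ⟩
          not (φ (north n))         ≡⟨ cong not (φ-north-on-east n p) ⟩
          true                      ≡⟨ cong not p ⟨
          not (dir n)               ∎
          where open ≡-Reasoning
        ... | inj₂ p = begin
          dir (suc n)               ≡⟨ dir-after-north n p ⟩
          φ (north (suc n))         ≡⟨ anti _ _ (trans (+-comm (north (suc n)) _) (east+north (suc n))) ⟩
          not (φ (east (suc n)))    ≡⟨ cong (not ∘ φ) (east-on-north n p) ⟩
          not (φ (east n))          ≡⟨ cong not (φ-east-on-north n p) ⟩
          false                     ≡⟨ cong not p ⟨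
          not (dir n)               ∎
          where open ≡-Reasoning
      reflected (suc j) n e rewrite +-suc L j
        with reflected j (suc n) (trans (sym (+-suc (suc n) j)) e) | false⊎true (dir (suc n))
      ... | d , en , ne | inj₁ q = dir-refl , en′ , ne′
        where
        p : dir (L + j) ≡ true
        p = trans d (cong not q)
        en′ : east (suc (L + j)) + north (suc n) ≡ L
        en′ = trans (cong₂ _+_ (east-on-north (L + j) p) (sym (north-on-east (suc n) q))) en
        ne′ : north (suc (L + j)) + east (suc n) ≡ L
        ne′ = trans (cong (_+ east (suc n)) (north-on-north (L + j) p))
          (trans (sym (+-suc (north (L + j)) _)) (trans (cong (north (L + j) +_) (sym (east-on-east (suc n) q))) ne))
        -- The forward rule gives the later step and the reversed rule the earlier one, from
        -- coordinates that sum to `L`; antisymmetry of `φ` makes the two opposite.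
        dir-refl : dir (suc (L + j)) ≡ not (dir n)
        dir-refl = trans (dir-after-north (L + j) p) (trans (anti _ _ ne′) (cong not (sym (dir-before-east n q))))
      ... | d , en , ne | inj₂ q = dir-refl , en′ , ne′
        where
        p : dir (L + j) ≡ false
        p = trans d (cong not q)
        en′ : east (suc (L + j)) + north (suc n) ≡ L
        en′ = trans (cong (_+ north (suc n)) (east-on-east (L + j) p))
          (trans (sym (+-suc (east (L + j)) _)) (trans (cong (east (L + j) +_) (sym (north-on-north (suc n) q))) en))
        ne′ : north (suc (L + j)) + east (suc n) ≡ L
        ne′ = trans (cong₂ _+_ (north-on-east (L + j) p) (sym (east-on-north (suc n) q))) ne
        dir-refl : dir (suc (L + j)) ≡ not (dir n)
        dir-refl = trans (dir-after-east (L + j) p) (trans (anti _ _ en′) (cong not (sym (dir-before-north n q))))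

      private
        dir-antisymmetric-≥ : ∀ i j → suc (i + j) ≡ L + L → suc j ≤ L → dir i ≡ not (dir j)
        dir-antisymmetric-≥ i j e j<L with m≤n⇒∃[o]m+o≡n j<L
        ... | d , f = subst (λ m → dir m ≡ not (dir j)) (sym i≡L+d) (proj₁ (reflected d j f))
          where
          open ≡-Reasoning
          i≡L+d : i ≡ L + d
          i≡L+d = +-cancelʳ-≡ (suc j) i (L + d) (begin
            i + suc j       ≡⟨ +-suc i j ⟩
            suc (i + j)     ≡⟨ e ⟩
            L + L           ≡⟨ cong (L +_) (trans (sym f) (+-comm (suc j) d)) ⟩
            L + (d + suc j) ≡⟨ +-assoc L d (suc j) ⟨
            L + d + suc j   ∎)

      dir-antisymmetric : ∀ i j → suc (i + j) ≡ L + L → dir i ≡ not (dir j)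
      dir-antisymmetric i j e with suc j ≤? L
      ... | yes j<L = dir-antisymmetric-≥ i j e j<L
      ... | no  j≮L = trans (sym (not-involutive (dir i)))
          (cong not (sym (dir-antisymmetric-≥ j i (trans (cong suc (+-comm j i)) e) i<L)))
        where
        L≤j : L ≤ j
        L≤j = ≤-pred (≰⇒> j≮L)
        i<L : suc i ≤ L
        i<L = +-cancelʳ-≤ L (suc i) L (≤-trans (+-monoʳ-≤ (suc i) L≤j) (≤-reflexive e))

    -- The end of the path.

    module _ {l : ℕ} (anti : Antisymmetric φ (suc l)) where

      private
        last : Reflected anti (suc l + l) 0
        last = reflected anti l 0 refl

        end : suc l + suc l ≡ suc (suc l + l)
        end = +-suc (suc l) l

        dir-last : dir (suc l + l) ≡ true
        dir-last = proj₁ last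

        north-last : north (suc l + l) ≡ l
        north-last = suc-injective (trans (sym (+-comm (north (suc l + l)) 1)) (proj₂ (proj₂ last)))

      -- The last step mirrors step 0, hence is north, and `east` is complete one step early. This
      -- supplies the starting values of the next block, where the indices of `A` and `B` are offset
      -- by one between the two kinds of block.
      east-last : east (suc l + l) ≡ suc l
      east-last = trans (sym (+-identityʳ _)) (proj₁ (proj₂ last))

      east-end : east (suc l + suc l) ≡ suc l
      east-end = trans (cong east end) (trans (east-on-north (suc l + l) dir-last) east-last)

      north-end : north (suc l + suc l) ≡ suc l
      north-end = trans (cong north end) (trans (north-on-north (suc l + l) dir-last) (cong suc north-last))

      -- This step lies just past the reflected range. It is needed as the partner of the letter
      -- that `delay` puts in front of the word.
      dir-end : dir (suc l + suc l) ≡ true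
      dir-end = begin
        dir (suc l + suc l)         ≡⟨ cong dir end ⟩
        dir (suc (suc l + l))       ≡⟨ dir-after-north (suc l + l) dir-last ⟩
        φ (north (suc (suc l + l))) ≡⟨ cong (φ ∘ north) end ⟨
        φ (north (suc l + suc l))   ≡⟨ cong φ north-end ⟩
        φ (suc l)                   ≡⟨ anti (suc l) 0 (+-identityʳ (suc l)) ⟩
        not (φ 0)                   ≡⟨ cong not φ0 ⟩
        true                        ∎
        where open ≡-Reasoning

      east-≤ : ∀ {k} → k ≤ suc l + suc l → east k ≤ suc l
      east-≤ {k} k≤ with m≤n⇒∃[o]m+o≡n k≤
      ... | d , e = ≤-trans (east-mono k d) (≤-reflexive (trans (cong east e) east-end))

      north-≤ : ∀ {k} → k ≤ suc l + suc l → north k ≤ suc l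
      north-≤ {k} k≤ with m≤n⇒∃[o]m+o≡n k≤
      ... | d , e = ≤-trans (north-mono k d) (≤-reflexive (trans (cong north e) north-end))

      -- One better than `north-≤`, since the last step is north. It fits the range of `A` in a
      -- negative block, one shorter than that of `B`.
      north-< : ∀ {k} → k < suc l + suc l → north k ≤ l
      north-< {k} k< with m≤n⇒∃[o]m+o≡n (≤-pred (subst (suc k ≤_) end k<))
      ... | d , e = ≤-trans (north-mono k d) (≤-reflexive (trans (cong north e) north-last))

-- Unfolding of `Qt` and oddness of its values.

≡ᵇ-refl : ∀ n → (n ≡ᵇ n) ≡ true
≡ᵇ-refl zero    = refl
≡ᵇ-refl (suc n) = ≡ᵇ-refl n

<⇒≢ᵇ : ∀ {m n} → m < n → (m ≡ᵇ n) ≡ false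
<⇒≢ᵇ {zero}  (s≤s _)   = refl
<⇒≢ᵇ {suc m} (s≤s m<n) = <⇒≢ᵇ m<n

tab≡Qt : ∀ n {k} → k ≤ n → tab n k ≡ Qt k
tab≡Qt zero z≤n = refl
tab≡Qt (suc n) {k} k≤1+n with m≤n⇒m<n∨m≡n k≤1+n
... | inj₂ refl = refl
... | inj₁ k<1+n rewrite <⇒≢ᵇ k<1+n = tab≡Qt n (≤-pred k<1+n)

Odd : ℕ → Set
Odd n = ∃ λ h → n ≡ suc (2 * h)

Qt-sum : ℕ → ℕ
Qt-sum n = Qt (3 + n ∸ Qt (2 + n)) + Qt (3 + n ∸ Qt (1 + n))

-- Oddness serves as positivity: subtracting at least 1 from `3 + n` keeps each argument within the
-- range where `tab (2 + n)` agrees with `Qt`.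
Qt-unfold : ∀ n → Odd (Qt (2 + n)) → Odd (Qt (1 + n)) →
  Qt (3 + n) ≡ (if isEven (3 + n) then Qt-sum n + 1 else Qt-sum n ∸ 1)
Qt-unfold n o o′ = trans
  (cong (λ b → if b then step (tab (2 + n)) (3 + n) else tab (2 + n) (3 + n)) (≡ᵇ-refl n))
  (cong (λ s → if isEven (3 + n) then s + 1 else s ∸ 1) (cong₂ _+_ (term o refl) (term o′ tab-1+n)))
  where
  tab-1+n : tab (2 + n) (1 + n) ≡ Qt (1 + n)
  tab-1+n = tab≡Qt (2 + n) (n≤1+n (1 + n))
  term : ∀ {q t} → Odd q → t ≡ q → tab (2 + n) (3 + n ∸ t) ≡ Qt (3 + n ∸ q)
  term (h , refl) refl = tab≡Qt (2 + n) (m∸n≤m (2 + n) (2 * h))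

-- Truncated subtraction of a positive value always gives a smaller index, and the dummy value at 0
-- is odd too, so strong induction works without a growth bound.
Qt-odd : ∀ n → Odd (Qt n)
Qt-odd = <-rec _ go
  where
  go : ∀ n → (∀ {m} → m < n → Odd (Qt m)) → Odd (Qt n)
  go 0 _ = 0 , refl
  go 1 _ = 0 , refl
  go 2 _ = 0 , refl
  go (suc (suc (suc n))) ih
    with ih {2 + n} ≤-refl | ih {1 + n} (n≤1+n _)
  ... | o | o′
    with ih {3 + n ∸ Qt (2 + n)} (before o) | ih {3 + n ∸ Qt (1 + n)} (before o′)
    where
    before : ∀ {q} → Odd q → 3 + n ∸ q < 3 + n
    before (h , refl) = s≤s (m∸n≤m (2 + n) (2 * h))
  ... | (x , e) | (y , e′)
    with isEven (3 + n) | Qt-unfold n o o′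
  ... | true  | f = 1 + x + y , trans f (trans (cong₂ (λ s t → s + t + 1) e e′) (lem x y))
    where
    lem : ∀ x y → suc (2 * x) + suc (2 * y) + 1 ≡ suc (2 * (1 + x + y))
    lem = solve-∀
  ... | false | f = x + y , trans f (trans (cong₂ (λ s t → s + t ∸ 1) e e′) (lem x y))
    where
    lem : ∀ x y → 2 * x + suc (2 * y) ≡ suc (2 * (x + y))
    lem = solve-∀

-- The recursions for `A` and `B`.

isEven-2* : ∀ m → isEven (m + m) ≡ true
isEven-2* zero = refl
isEven-2* (suc m) rewrite +-suc m m | isEven-2* m = refl

halve : ∀ {q} → Odd q → 2 * ((q + 1) / 2) ≡ suc q
halve {q} (h , refl) = begin
  2 * ((suc (2 * h) + 1) / 2) ≡⟨ cong (λ n → 2 * (n / 2)) (lem h) ⟩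
  2 * (suc h * 2 / 2)         ≡⟨ cong (2 *_) (m*n/n≡m (suc h) 2) ⟩
  2 * suc h                   ≡⟨ lem′ h ⟩
  suc (suc (2 * h))           ∎
  where
  open ≡-Reasoning
  lem : ∀ h → suc (2 * h) + 1 ≡ suc h * 2
  lem = solve-∀
  lem′ : ∀ h → 2 * suc h ≡ suc (suc (2 * h))
  lem′ = solve-∀

2*A : ∀ m → 2 * A m ≡ suc (Qt (2 * m ∸ 1))
2*A m = halve (Qt-odd (2 * m ∸ 1))

2*B : ∀ m → 2 * B m ≡ suc (Qt (2 * m))
2*B m = halve (Qt-odd (2 * m))

Qt-even : ∀ m → Qt (4 + 2 * m) ≡ Qt-sum (1 + 2 * m) + 1
Qt-even m = trans (Qt-unfold (1 + 2 * m) (Qt-odd (3 + 2 * m)) (Qt-odd (2 + 2 * m)))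
  (cong (λ b → if b then Qt-sum (1 + 2 * m) + 1 else Qt-sum (1 + 2 * m) ∸ 1) even)
  where
  even : isEven (4 + 2 * m) ≡ true
  even rewrite +-identityʳ m | isEven-2* m = refl

-- The `suc` undoes the truncated `∸ 1`, exact because the sum is positive.
Qt-odd-index : ∀ m → suc (Qt (3 + 2 * m)) ≡ Qt-sum (2 * m)
Qt-odd-index m = trans (cong suc (trans (Qt-unfold (2 * m) (Qt-odd (2 + 2 * m)) (Qt-odd (1 + 2 * m)))
    (cong (λ b → if b then Qt-sum (2 * m) + 1 else Qt-sum (2 * m) ∸ 1) odd)))
  (m+[n∸m]≡n {1} pos)
  where
  odd : isEven (3 + 2 * m) ≡ false
  odd rewrite +-identityʳ m | isEven-2* m = refl
  pos : 1 ≤ Qt-sum (2 * m)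
  pos with Qt-odd (3 + 2 * m ∸ Qt (2 + 2 * m))
  ... | h , e = ≤-trans (≤-trans (s≤s z≤n) (≤-reflexive (sym e))) (m≤m+n _ _)

-- Turns an argument n − Q̃(·) of the recursion into an index of A (c = 1) or of B (c = 0).
∸-reindex : ∀ c n q h x → 2 * h ≡ suc q → x + h ≡ n → 2 * n ∸ suc c ∸ q ≡ 2 * x ∸ c
∸-reindex c n q h x e refl = begin
  2 * (x + h) ∸ suc c ∸ q       ≡⟨ cong (λ m → m ∸ suc c ∸ q) (*-distribˡ-+ 2 x h) ⟩
  (2 * x + 2 * h) ∸ suc c ∸ q   ≡⟨ cong (λ m → (2 * x + m) ∸ suc c ∸ q) e ⟩
  (2 * x + suc q) ∸ suc c ∸ q   ≡⟨ cong (λ m → m ∸ suc c ∸ q) (+-suc (2 * x) q) ⟩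
  (2 * x + q) ∸ c ∸ q           ≡⟨ ∸-+-assoc (2 * x + q) c q ⟩
  (2 * x + q) ∸ (c + q)         ≡⟨ [m+n]∸[o+n]≡m∸o (2 * x) q c ⟩
  2 * x ∸ c                     ∎
  where
  open ≡-Reasoning
  [m+n]∸[o+n]≡m∸o : ∀ m n o → (m + n) ∸ (o + n) ≡ m ∸ o
  [m+n]∸[o+n]≡m∸o m n o = trans (cong₂ _∸_ (+-comm m n) (+-comm o n)) ([m+n]∸[m+o]≡n∸o n m o)

-- With n = 2 + m, the arguments are 2(n+1-A(n))-1 and 2(n+1-B(n-1))-1, both odd, so both summands
-- are values of `A`. Additive equations for `x` and `y` avoid truncated subtraction.
B-rec : ∀ m x y → x + A (2 + m) ≡ 3 + m → y + B (1 + m) ≡ 3 + m → B (2 + m) ≡ A x + A y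
B-rec m x y ex ey = *-cancelˡ-≡ _ _ 2 (begin
  2 * B (2 + m)                                  ≡⟨ 2*B (2 + m) ⟩
  suc (Qt (2 * (2 + m)))                         ≡⟨ cong (suc ∘ Qt) (4+ m) ⟩
  suc (Qt (4 + 2 * m))                           ≡⟨ cong suc (Qt-even m) ⟩
  suc (Qt i + Qt j + 1)                          ≡⟨ lem (Qt i) (Qt j) ⟩
  suc (Qt i) + suc (Qt j)                        ≡⟨ cong₂ (λ s t → suc (Qt s) + suc (Qt t)) i≡ j≡ ⟩
  suc (Qt (2 * x ∸ 1)) + suc (Qt (2 * y ∸ 1))    ≡⟨ cong₂ _+_ (2*A x) (2*A y) ⟨
  2 * A x + 2 * A y                              ≡⟨ *-distribˡ-+ 2 (A x) (A y) ⟨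
  2 * (A x + A y)                                ∎)
  where
  open ≡-Reasoning
  i = 4 + 2 * m ∸ Qt (3 + 2 * m)
  j = 4 + 2 * m ∸ Qt (2 + 2 * m)
  4+ : ∀ m → 2 * (2 + m) ≡ 4 + 2 * m
  4+ = solve-∀
  2+ : ∀ m → 2 * (1 + m) ≡ 2 + 2 * m
  2+ = solve-∀
  6+ : ∀ m → 2 * (3 + m) ≡ 6 + 2 * m
  6+ = solve-∀
  lem : ∀ s t → suc (s + t + 1) ≡ suc s + suc t
  lem = solve-∀
  i≡ : i ≡ 2 * x ∸ 1
  i≡ = trans (cong (λ n → n ∸ 2 ∸ Qt (3 + 2 * m)) (sym (6+ m)))
    (∸-reindex 1 (3 + m) _ (A (2 + m)) x
      (trans (2*A (2 + m)) (cong (λ n → suc (Qt (n ∸ 1))) (4+ m))) ex)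
  j≡ : j ≡ 2 * y ∸ 1
  j≡ = trans (cong (λ n → n ∸ 2 ∸ Qt (2 + 2 * m)) (sym (6+ m)))
    (∸-reindex 1 (3 + m) _ (B (1 + m)) y
      (trans (2*B (1 + m)) (cong (λ n → suc (Qt n)) (2+ m))) ey)

-- With n = 2 + m, the arguments are 2(n-B(n-1)) and 2(n-A(n-1)), both even, so both summands are
-- values of `B`.
A-rec : ∀ m x y → x + B (1 + m) ≡ 2 + m → y + A (1 + m) ≡ 2 + m → suc (A (2 + m)) ≡ B x + B y
A-rec m x y ex ey = *-cancelˡ-≡ _ _ 2 (begin
  2 * suc (A (2 + m))                      ≡⟨ *-suc 2 (A (2 + m)) ⟩
  2 + 2 * A (2 + m)                        ≡⟨ cong (2 +_) (2*A (2 + m)) ⟩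
  3 + Qt (2 * (2 + m) ∸ 1)                 ≡⟨ cong (λ n → 3 + Qt (n ∸ 1)) (4+ m) ⟩
  3 + Qt (3 + 2 * m)                       ≡⟨ cong (2 +_) (Qt-odd-index m) ⟩
  2 + (Qt i + Qt j)                        ≡⟨ lem (Qt i) (Qt j) ⟩
  suc (Qt i) + suc (Qt j)                  ≡⟨ cong₂ (λ s t → suc (Qt s) + suc (Qt t)) i≡ j≡ ⟩
  suc (Qt (2 * x)) + suc (Qt (2 * y))      ≡⟨ cong₂ _+_ (2*B x) (2*B y) ⟨
  2 * B x + 2 * B y                        ≡⟨ *-distribˡ-+ 2 (B x) (B y) ⟨
  2 * (B x + B y)                          ∎)
  where
  open ≡-Reasoning
  i = 3 + 2 * m ∸ Qt (2 + 2 * m)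
  j = 3 + 2 * m ∸ Qt (1 + 2 * m)
  4+ : ∀ m → 2 * (2 + m) ≡ 4 + 2 * m
  4+ = solve-∀
  2+ : ∀ m → 2 * (1 + m) ≡ 2 + 2 * m
  2+ = solve-∀
  lem : ∀ s t → 2 + (s + t) ≡ suc s + suc t
  lem = solve-∀
  i≡ : i ≡ 2 * x
  i≡ = trans (cong (λ n → n ∸ 1 ∸ Qt (2 + 2 * m)) (sym (4+ m)))
    (∸-reindex 0 (2 + m) _ (B (1 + m)) x
      (trans (2*B (1 + m)) (cong (λ n → suc (Qt n)) (2+ m))) ex)
  j≡ : j ≡ 2 * y
  j≡ = trans (cong (λ n → n ∸ 1 ∸ Qt (1 + 2 * m)) (sym (4+ m)))
    (∸-reindex 0 (2 + m) _ (A (1 + m)) y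
      (trans (2*A (1 + m)) (cong (λ n → suc (Qt (n ∸ 1))) (2+ m))) ey)

-- The numbers `a r` and `u r`, and the two kinds of block.

-- The witness is a_r - 1, and a_{r+1} = 4a_r - 1 turns `d` into `2 + 4 * d`. The bound makes the
-- subtractions in `u` exact.
3*a : ∀ r → ∃ λ d → 2 * 4 ^ (r + 1) + 1 ≡ suc d * 3 × r + 2 ≤ d
3*a zero = 2 , refl , ≤-refl
3*a (suc r) with 3*a r
... | d , e , b = 2 + 4 * d , times4 (4 ^ (r + 1)) e , bound
  where
  bound : suc r + 2 ≤ 2 + 4 * d
  bound = ≤-trans (s≤s (≤-trans b (m≤m+n d (3 * d)))) (n≤1+n _)
  times4 : ∀ p → 2 * p + 1 ≡ suc d * 3 → 2 * (4 * p) + 1 ≡ suc (2 + 4 * d) * 3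
  times4 p e = +-cancelʳ-≡ 3 _ _ (begin
    2 * (4 * p) + 1 + 3       ≡⟨ lem p ⟩
    4 * (2 * p + 1)           ≡⟨ cong (4 *_) e ⟩
    4 * (suc d * 3)           ≡⟨ lem′ d ⟩
    suc (2 + 4 * d) * 3 + 3   ∎)
    where
    open ≡-Reasoning
    lem : ∀ p → 2 * (4 * p) + 1 + 3 ≡ 4 * (2 * p + 1)
    lem = solve-∀
    lem′ : ∀ d → 4 * (suc d * 3) ≡ suc (2 + 4 * d) * 3 + 3
    lem′ = solve-∀

a-pred : ℕ → ℕ
a-pred r = proj₁ (3*a r)

a≡ : ∀ r → a r ≡ suc (a-pred r)
a≡ r = trans (cong (_/ 3) (proj₁ (proj₂ (3*a r)))) (m*n/n≡m (suc (a-pred r)) 3)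

r+2≤a-pred : ∀ r → r + 2 ≤ a-pred r
r+2≤a-pred r = proj₂ (proj₂ (3*a r))

u-exact : ∀ r → u r + (r + 2) ≡ 2 * a r
u-exact r = trans (cong (_+ (r + 2)) (∸-+-assoc (2 * a r) r 2)) (m∸n+n≡m (begin
  r + 2       ≤⟨ r+2≤a-pred r ⟩
  a-pred r    ≤⟨ n≤1+n _ ⟩
  suc (a-pred r) ≡⟨ a≡ r ⟨
  a r         ≤⟨ m≤m+n (a r) _ ⟩
  2 * a r     ∎))
  where open ≤-Reasoning

-- Describes A and B on [u_r , v_r] when a_r = suc d.
record PosBlock (u d : ℕ) : Set where
  field
    φ    : ℕ → Bool
    φ0   : φ 0 ≡ false
    anti : Antisymmetric φ (suc d)
  open Path φ public
  field
    A≡ : ∀ {k} → k ≤ suc d + suc d → A (u + k) ≡ suc d + north k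
    B≡ : ∀ {k} → k ≤ suc d + suc d → B (u + k) ≡ suc d + east k

-- Describes A and B on [v_r , u_{r+1}] when v_r = 2 + w and 2 a_r = 2 + l.
record NegBlock (w l : ℕ) : Set where
  field
    φ    : ℕ → Bool
    φ0   : φ 0 ≡ false
    anti : Antisymmetric φ (suc l)
  open Path φ public
  field
    A≡ : ∀ {k} → k ≤ suc l + suc l → A (2 + w + k) ≡ 2 + l + east k
    B≡ : ∀ {k} → k ≤ suc (suc l + suc l) → B (1 + w + k) ≡ 2 + l + north k

-- From a positive block to the negative block after it.

-- The driving word is `P.dir` itself. All arguments of the recursions fall in the positive block,
-- where `A` and `B` are a constant plus a count of letters of `P.dir`, so the two counting
-- identities close the induction.
pos→neg : ∀ {u d} → PosBlock u d → NegBlock (u + (d + d)) (d + d)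
pos→neg {u} {d} pos = record
  { φ = P.dir ; φ0 = refl ; anti = anti
  ; A≡ = λ {k} k≤ → proj₁ (state k k≤)
  ; B≡ = B≡
  }
  where
  module P = PosBlock pos
  module N = Path P.dir
  w l : ℕ
  w = u + (d + d)
  l = d + d

  anti : Antisymmetric P.dir (suc l)
  anti i j e = P.dir-antisymmetric P.φ0 P.anti i j (trans (cong suc e) (cong suc (sym (+-suc d d))))

  within : ∀ {k} → k ≤ 2 + l → k ≤ suc d + suc d
  within k≤ = ≤-trans k≤ (≤-reflexive (cong suc (sym (+-suc d d))))

  State : ℕ → Set
  State k = A (2 + w + k) ≡ 2 + l + N.east k × B (1 + w + k) ≡ 2 + l + N.north k

  B-next : ∀ k → k ≤ suc l + suc l → State k → B (2 + w + k) ≡ 2 + l + N.north (suc k)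
  B-next k k≤ (Ak , Bk) = begin
    B (2 + (w + k))
      ≡⟨ B-rec (w + k) (u + suc y) (u + suc x)
           (trans (cong (u + suc y +_) Ak) (trans (ix u d x y) (cong (λ k → 3 + (w + k)) (N.east+north k))))
           (trans (cong (u + suc x +_) Bk) (trans (iy u d x y) (cong (λ k → 3 + (w + k)) (N.east+north k)))) ⟩
    A (u + suc y) + A (u + suc x)
      ≡⟨ cong₂ _+_ (P.A≡ (within (s≤s (N.north-≤ refl anti k≤))))
                   (P.A≡ (within (s≤s (N.east-≤ refl anti k≤)))) ⟩
    (suc d + P.north (suc y)) + (suc d + P.north (suc x))
      ≡⟨ sum d (P.north (suc y)) (P.north (suc x)) ⟩
    2 + l + (P.north (suc x) + P.north (suc y))
      ≡⟨ cong (2 + l +_) (cong₂ _+_ (P.north≡count (suc x)) (P.north≡count (suc y))) ⟩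
    2 + l + (count P.dir (suc x) + count P.dir (suc y))
      ≡⟨ cong (2 + l +_) (N.north-suc≡counts refl k) ⟨
    2 + l + N.north (suc k) ∎
    where
    open ≡-Reasoning
    x = N.east k
    y = N.north k
    ix : ∀ u d x y → u + suc y + (2 + (d + d) + x) ≡ 3 + (u + (d + d) + (x + y))
    ix = solve-∀
    iy : ∀ u d x y → u + suc x + (2 + (d + d) + y) ≡ 3 + (u + (d + d) + (x + y))
    iy = solve-∀
    sum : ∀ d s t → (suc d + s) + (suc d + t) ≡ 2 + (d + d) + (t + s)
    sum = solve-∀

  -- This uses the `B` just computed, which is why one offset is `N.east (suc k)` while the other is
  -- still taken at point `k`.
  A-next : ∀ k → suc k ≤ suc l + suc l → State k → A (3 + w + k) ≡ 2 + l + N.east (suc k)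
  A-next k k< s@(Ak , Bk) = suc-injective (begin
    suc (A (2 + (1 + w + k)))
      ≡⟨ A-rec (1 + w + k) (u + x′) (u + suc y)
           (trans (cong (u + x′ +_) (B-next k (<⇒≤ k<) s))
             (trans (ix u d x′ (N.north (suc k)))
               (trans (cong (λ k → 2 + (w + k)) (N.east+north (suc k))) (cong (2 +_) (+-suc w k)))))
           (trans (cong (u + suc y +_) Ak)
             (trans (iy u d (N.east k) y) (cong (λ k → 3 + (w + k)) (N.east+north k)))) ⟩
    B (u + x′) + B (u + suc y)
      ≡⟨ cong₂ _+_ (P.B≡ (within (≤-trans (N.east-≤ refl anti k<) (n≤1+n _))))
                   (P.B≡ (within (s≤s (N.north-≤ refl anti (<⇒≤ k<))))) ⟩
    (suc d + P.east x′) + (suc d + P.east (suc y))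
      ≡⟨ sum d (P.east x′) (P.east (suc y)) ⟩
    2 + l + (P.east x′ + P.east (suc y))
      ≡⟨ cong (2 + l +_) (cong₂ _+_ (P.east≡count x′) (P.east≡count (suc y))) ⟩
    2 + l + (count (not ∘ P.dir) x′ + count (not ∘ P.dir) (suc y))
      ≡⟨ cong (2 + l +_) (N.east-suc≡counts refl k) ⟨
    2 + l + suc x′
      ≡⟨ +-suc (2 + l) x′ ⟩
    suc (2 + l + x′) ∎)
    where
    open ≡-Reasoning
    x′ = N.east (suc k)
    y  = N.north k
    ix : ∀ u d x y → u + x + (2 + (d + d) + y) ≡ 2 + (u + (d + d) + (x + y))
    ix = solve-∀
    iy : ∀ u d x y → u + suc y + (2 + (d + d) + x) ≡ 3 + (u + (d + d) + (x + y))
    iy = solve-∀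
    sum : ∀ d s t → (suc d + s) + (suc d + t) ≡ 2 + (d + d) + (s + t)
    sum = solve-∀

  state : ∀ k → k ≤ suc l + suc l → State k
  state zero _ = A₀ , B₀
    where
    A₀ : A (2 + w + 0) ≡ 2 + l + 0
    A₀ = trans (cong A (lem u d)) (trans (P.A≡ ≤-refl)
      (trans (cong (suc d +_) (P.north-end P.φ0 P.anti)) (lem′ d)))
      where
      lem : ∀ u d → 2 + (u + (d + d)) + 0 ≡ u + (suc d + suc d)
      lem = solve-∀
      lem′ : ∀ d → suc d + suc d ≡ 2 + (d + d) + 0
      lem′ = solve-∀
    -- One index before the end of the positive block, where `east` is already complete.
    B₀ : B (1 + w + 0) ≡ 2 + l + 0
    B₀ = trans (cong B (lem u d)) (trans (P.B≡ (+-monoʳ-≤ (suc d) (n≤1+n d)))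
      (trans (cong (suc d +_) (P.east-last P.φ0 P.anti)) (lem′ d)))
      where
      lem : ∀ u d → 1 + (u + (d + d)) + 0 ≡ u + (suc d + d)
      lem = solve-∀
      lem′ : ∀ d → suc d + suc d ≡ 2 + (d + d) + 0
      lem′ = solve-∀
  state (suc k) k< =
      trans (cong A (+-suc (2 + w) k)) (A-next k k< (state k (<⇒≤ k<)))
    , trans (cong B (+-suc (1 + w) k)) (B-next k (<⇒≤ k<) (state k (<⇒≤ k<)))

  -- Computing `B` needs only the state reached so far, so `B` is known one offset beyond the state;
  -- the next positive block reads `B` as far as this offset.
  B≡ : ∀ {k} → k ≤ suc (suc l + suc l) → B (1 + w + k) ≡ 2 + l + N.north k
  B≡ {zero}  _        = proj₂ (state 0 z≤n)
  B≡ {suc k} (s≤s k≤) = trans (cong B (+-suc (1 + w) k)) (B-next k k≤ (state k k≤))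

-- From a negative block to the positive block after it.

-- A positive block reads the block before it one offset earlier than a negative block does. A
-- letter `false` in front of the word absorbs this shift, so that the same counting identities
-- apply.
delay : (ℕ → Bool) → ℕ → Bool
delay f zero    = false
delay f (suc n) = f n

count-delay : ∀ f n → count (delay f) (suc n) ≡ count f n
count-delay f zero    = refl
count-delay f (suc n) = cong (bit (f n) +_) (count-delay f n)

count-not-delay : ∀ f n → count (not ∘ delay f) (suc n) ≡ suc (count (not ∘ f) n)
count-not-delay f zero    = refl
count-not-delay f (suc n) = trans (cong (bit (not (f n)) +_) (count-not-delay f n)) (+-suc _ _)

neg→pos : ∀ {w l} → NegBlock w l → PosBlock (1 + w + (suc l + suc l)) (suc l + suc l)
neg→pos {w} {l} neg = record
  { φ = φ ; φ0 = refl ; anti = anti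
  ; A≡ = λ {k} k≤ → proj₁ (state k k≤)
  ; B≡ = λ {k} k≤ → proj₂ (state k k≤)
  }
  where
  module N = NegBlock neg
  φ = delay N.dir
  module P = Path φ
  L d u′ : ℕ
  L = suc l
  d = L + L
  u′ = 1 + w + d

  anti : Antisymmetric φ (suc d)
  -- The letter in front is paired with the step just past the negative block, which is north.
  anti zero    (suc j) e = cong not (sym (trans (cong N.dir (suc-injective e)) (N.dir-end N.φ0 N.anti)))
  anti (suc i) zero    e =
    trans (cong N.dir (trans (sym (+-identityʳ i)) (suc-injective e))) (N.dir-end N.φ0 N.anti)
  anti (suc i) (suc j) e =
    N.dir-antisymmetric N.φ0 N.anti i j (trans (sym (+-suc i j)) (suc-injective e))

  State : ℕ → Set
  State k = A (u′ + k) ≡ suc d + P.north k × B (u′ + k) ≡ suc d + P.east k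

  A-next : ∀ k → k ≤ suc d + suc d → State k → A (1 + u′ + k) ≡ suc d + P.north (suc k)
  A-next k k≤ (Ak , Bk) = suc-injective (begin
    suc (A (2 + (w + d + k)))
      ≡⟨ A-rec (w + d + k) (1 + w + y) (1 + w + x)
           (trans (cong (1 + w + y +_) Bk) (trans (ix w d x y) (cong (λ k → 2 + (w + d + k)) (P.east+north k))))
           (trans (cong (1 + w + x +_) Ak) (trans (iy w d x y) (cong (λ k → 2 + (w + d + k)) (P.east+north k)))) ⟩
    B (1 + w + y) + B (1 + w + x)
      ≡⟨ cong₂ _+_ (N.B≡ (P.north-≤ refl anti k≤)) (N.B≡ (P.east-≤ refl anti k≤)) ⟩
    (suc L + N.north y) + (suc L + N.north x)
      ≡⟨ sum L (N.north y) (N.north x) ⟩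
    suc (suc d + (N.north x + N.north y))
      ≡⟨ cong (λ n → suc (suc d + n)) (cong₂ _+_ (N-count x) (N-count y)) ⟩
    suc (suc d + (count φ (suc x) + count φ (suc y)))
      ≡⟨ cong (λ n → suc (suc d + n)) (P.north-suc≡counts refl k) ⟨
    suc (suc d + P.north (suc k)) ∎)
    where
    open ≡-Reasoning
    x = P.east k
    y = P.north k
    N-count : ∀ n → N.north n ≡ count φ (suc n)
    N-count n = trans (N.north≡count n) (sym (count-delay N.dir n))
    ix : ∀ w d x y → 1 + w + y + (suc d + x) ≡ 2 + (w + d + (x + y))
    ix = solve-∀
    iy : ∀ w d x y → 1 + w + x + (suc d + y) ≡ 2 + (w + d + (x + y))
    iy = solve-∀
    sum : ∀ L s t → (suc L + s) + (suc L + t) ≡ suc (suc (L + L) + (t + s))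
    sum = solve-∀

  B-next : ∀ k → suc k ≤ suc d + suc d → State k → B (1 + u′ + k) ≡ suc d + P.east (suc k)
  -- The index read is `1 + w + P.east (suc k)`, while `N.A≡` starts at `2 + w`; since the first
  -- step is east, a predecessor `x` exists.
  B-next k k< s@(Ak , Bk) with P.east-suc k
  ... | x , x≡ = begin
    B (2 + (w + d + k))
      ≡⟨ B-rec (w + d + k) (2 + w + x) (2 + w + y) ix iy ⟩
    A (2 + w + x) + A (2 + w + y)
      ≡⟨ cong₂ _+_ (N.A≡ (≤-pred (≤-trans (≤-reflexive (sym x≡)) (P.east-≤ refl anti k<))))
                   (N.A≡ (P.north-< refl anti k<)) ⟩
    (suc L + N.east x) + (suc L + N.east y)
      ≡⟨ sum L (N.east x) (N.east y) ⟩
    d + (suc (N.east x) + suc (N.east y))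
      ≡⟨ cong (d +_) (cong₂ _+_ (N-count x) (N-count y)) ⟩
    d + (C (suc x) + C (suc y))
      ≡⟨ cong (λ n → d + (C n + C (suc y))) x≡ ⟨
    d + (C (P.east (suc k)) + C (suc y))
      ≡⟨ cong (d +_) (P.east-suc≡counts refl k) ⟨
    d + suc (P.east (suc k))
      ≡⟨ +-suc d _ ⟩
    suc d + P.east (suc k) ∎
    where
    open ≡-Reasoning
    C = count (not ∘ φ)
    y = P.north k
    N-count : ∀ n → suc (N.east n) ≡ C (suc n)
    N-count n = trans (cong suc (N.east≡count n)) (sym (count-not-delay N.dir n))
    sum : ∀ L s t → (suc L + s) + (suc L + t) ≡ L + L + (suc s + suc t)
    sum = solve-∀
    ix : 2 + w + x + A (2 + (w + d + k)) ≡ 3 + (w + d + k)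
    ix = begin
      2 + w + x + A (2 + (w + d + k))
        ≡⟨ cong (2 + w + x +_) (A-next k (<⇒≤ k<) s) ⟩
      2 + w + x + (suc d + P.north (suc k))
        ≡⟨ lem w d x (P.north (suc k)) ⟩
      2 + (w + d + (suc x + P.north (suc k)))
        ≡⟨ cong (λ n → 2 + (w + d + n)) (trans (cong (_+ P.north (suc k)) (sym x≡)) (P.east+north (suc k))) ⟩
      2 + (w + d + suc k)
        ≡⟨ cong (2 +_) (+-suc (w + d) k) ⟩
      3 + (w + d + k) ∎
      where
      lem : ∀ w d x y → 2 + w + x + (suc d + y) ≡ 2 + (w + d + (suc x + y))
      lem = solve-∀
    iy : 2 + w + y + B (1 + (w + d + k)) ≡ 3 + (w + d + k)
    iy = trans (cong (2 + w + y +_) Bk)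
      (trans (lem w d (P.east k) y) (cong (λ n → 3 + (w + d + n)) (P.east+north k)))
      where
      lem : ∀ w d x y → 2 + w + y + (suc d + x) ≡ 3 + (w + d + (x + y))
      lem = solve-∀

  state : ∀ k → k ≤ suc d + suc d → State k
  state zero _ = A₀ , B₀
    where
    A₀ : A (u′ + 0) ≡ suc d + 0
    A₀ = trans (cong A (lem w l)) (trans (N.A≡ (+-monoʳ-≤ (suc l) (n≤1+n l)))
      (trans (cong (2 + l +_) (N.east-last N.φ0 N.anti)) (sym (+-identityʳ (suc d)))))
      where
      lem : ∀ w l → 1 + w + (suc l + suc l) + 0 ≡ 2 + w + (suc l + l)
      lem = solve-∀
    B₀ : B (u′ + 0) ≡ suc d + 0
    B₀ = trans (cong B (+-identityʳ u′)) (trans (N.B≡ (n≤1+n _))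
      (trans (cong (2 + l +_) (N.north-end N.φ0 N.anti)) (sym (+-identityʳ (suc d)))))
  state (suc k) k< =
      trans (cong A (+-suc u′ k)) (A-next k (<⇒≤ k<) (state k (<⇒≤ k<)))
    , trans (cong B (+-suc u′ k)) (B-next k k< (state k (<⇒≤ k<)))

-- The initial block and the induction on `r`.

-- Here a_0 = 3 and u_0 = 4. The word 0011 drives the path with steps 001011, and the values at
-- indices 4 to 10 are checked by evaluation.
posBlock₀ : PosBlock 4 2
posBlock₀ = record { φ = φ ; φ0 = refl ; anti = anti ; A≡ = A≡ ; B≡ = B≡ }
  where
  φ : ℕ → Bool
  φ 0 = false
  φ 1 = false
  φ _ = true
  open Path φ
  anti : Antisymmetric φ 3
  anti 0 _ refl = refl
  anti 1 _ refl = refl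
  anti 2 _ refl = refl
  anti 3 _ refl = refl
  A≡ : ∀ {k} → k ≤ 6 → A (4 + k) ≡ 3 + north k
  A≡ {0} _ = refl
  A≡ {1} _ = refl
  A≡ {2} _ = refl
  A≡ {3} _ = refl
  A≡ {4} _ = refl
  A≡ {5} _ = refl
  A≡ {6} _ = refl
  A≡ {suc (suc (suc (suc (suc (suc (suc _))))))} (s≤s (s≤s (s≤s (s≤s (s≤s (s≤s ()))))))
  B≡ : ∀ {k} → k ≤ 6 → B (4 + k) ≡ 3 + east k
  B≡ {0} _ = refl
  B≡ {1} _ = refl
  B≡ {2} _ = refl
  B≡ {3} _ = refl
  B≡ {4} _ = refl
  B≡ {5} _ = refl
  B≡ {6} _ = refl
  B≡ {suc (suc (suc (suc (suc (suc (suc _))))))} (s≤s (s≤s (s≤s (s≤s (s≤s (s≤s ()))))))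

a-pred-suc : ∀ r → a-pred (suc r) ≡ suc (a-pred r + a-pred r) + suc (a-pred r + a-pred r)
a-pred-suc r = lem (a-pred r)
  where
  lem : ∀ d → 2 + 4 * d ≡ suc (d + d) + suc (d + d)
  lem = solve-∀

-- The next positive block starts where `neg→pos` places it: both sides exceed u_r by 6a_r - 3.
u-suc : ∀ r → let l = a-pred r + a-pred r in u (suc r) ≡ 1 + (u r + l) + (suc l + suc l)
u-suc r = +-cancelʳ-≡ (suc r + 2) _ _ (begin
  u (suc r) + (suc r + 2)                       ≡⟨ u-exact (suc r) ⟩
  2 * a (suc r)                                 ≡⟨ cong (2 *_) (a≡ (suc r)) ⟩
  2 * suc (2 + 4 * d)                           ≡⟨ lem d ⟩
  2 * suc d + (4 + 6 * d)                       ≡⟨ cong (λ n → 2 * n + (4 + 6 * d)) (a≡ r) ⟨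
  2 * a r + (4 + 6 * d)                         ≡⟨ cong (_+ (4 + 6 * d)) (u-exact r) ⟨
  u r + (r + 2) + (4 + 6 * d)                   ≡⟨ lem′ (u r) r d ⟩
  1 + (u r + (d + d)) + (suc (d + d) + suc (d + d)) + (suc r + 2) ∎)
  where
  open ≡-Reasoning
  d = a-pred r
  lem : ∀ d → 2 * suc (2 + 4 * d) ≡ 2 * suc d + (4 + 6 * d)
  lem = solve-∀
  lem′ : ∀ u r d → u + (r + 2) + (4 + 6 * d) ≡
    1 + (u + (d + d)) + (suc (d + d) + suc (d + d)) + (suc r + 2)
  lem′ = solve-∀

posBlock : ∀ r → PosBlock (u r) (a-pred r)
posBlock zero    = posBlock₀
posBlock (suc r) = subst₂ PosBlock (sym (u-suc r)) (sym (a-pred-suc r)) (neg→pos (pos→neg (posBlock r)))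

-- Anti-palindromicity of the step words.

bit-not : ∀ b → toℤ (bit (not b)) +ℤ toℤ (bit b) ≡ 1ℤ
bit-not false = refl
bit-not true  = refl

theorem3p11 : (∀ r → H1 r) →
    ∀ r k → k < 2 * a r → P r k +ℤ P r (2 * a r ∸ 1 ∸ k) ≡ 1ℤ
theorem3p11 _ r k k< = begin
  P r k +ℤ P r k′
    ≡⟨ cong₂ _+ℤ_ (P≡dir k (subst (k <_) 2a≡ k<)) (P≡dir k′ k′<) ⟩
  toℤ (bit (dir k)) +ℤ toℤ (bit (dir k′))
    ≡⟨ cong (λ b → toℤ (bit b) +ℤ toℤ (bit (dir k′))) (dir-antisymmetric φ0 anti k k′ k+k′) ⟩
  toℤ (bit (not (dir k′))) +ℤ toℤ (bit (dir k′))
    ≡⟨ bit-not (dir k′) ⟩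
  1ℤ ∎
  where
  open ≡-Reasoning
  open PosBlock (posBlock r)
  d k′ : ℕ
  d = a-pred r
  k′ = 2 * a r ∸ 1 ∸ k

  2a≡ : 2 * a r ≡ suc d + suc d
  2a≡ = trans (cong (2 *_) (a≡ r)) (cong (λ n → suc d + n) (+-identityʳ (suc d)))

  k+k′ : suc (k + k′) ≡ suc d + suc d
  k+k′ = trans (cong (λ n → suc k + n) (∸-+-assoc (2 * a r) 1 k)) (trans (m+[n∸m]≡n k<) 2a≡)

  k′< : k′ < suc d + suc d
  k′< = ≤-trans (s≤s (m≤n+m k′ k)) (≤-reflexive k+k′)

  -- In a positive block `A` follows the north coordinate, so its increment is the bit of the step.
  P≡dir : ∀ k → k < suc d + suc d → P r k ≡ toℤ (bit (dir k))
  P≡dir k k< = begin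
    toℤ (A (suc (u r + k))) -ℤ toℤ (A (u r + k))
      ≡⟨ cong₂ (λ m n → toℤ m -ℤ toℤ n)
           (trans (cong A (sym (+-suc (u r) k))) (A≡ k<)) (A≡ (<⇒≤ k<)) ⟩
    toℤ (suc d + (b + north k)) -ℤ toℤ (suc d + north k)
      ≡⟨ ℤ.m-n≡m⊖n (suc d + (b + north k)) (suc d + north k) ⟩
    (suc d + (b + north k)) ⊖ (suc d + north k)
      ≡⟨ cong (_⊖ (suc d + north k)) (lem d b (north k)) ⟩
    (suc d + north k + b) ⊖ (suc d + north k)
      ≡⟨ ℤ.⊖-≥ (m≤m+n (suc d + north k) b) ⟩
    toℤ (suc d + north k + b ∸ (suc d + north k))
      ≡⟨ cong toℤ (m+n∸m≡n (suc d + north k) b) ⟩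
    toℤ b ∎
    where
    b = bit (dir k)
    lem : ∀ d b n → suc d + (b + n) ≡ suc d + n + b
    lem = solve-∀
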